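{- For every integer $k\ge 1$, $\alpha_{3,2k+1}$ is equal to the number of ternary words of length $k+1$ over the alphabet $\{1,2,3\}$ containing at least one occurrence of $13$ or $31$ as a factor. This number is given by the term A193519$(k+1)$ of the OEIS sequence A193519.
   Context: For integers $n,m\ge 1$, the grid $G(n,m)$ has cell set $V_{n,m}=\{(i,j): 1\le i\le n,\ 1\le j\le m\}$ ($i$ = row, $j$ = column). Contamination rules: a cell $u=(i,j)\in V_{n,m}$ can be contaminated by two contaminated cells $v,w\in V_{n,m}$ if one of the following holds: (a) $v=(i-1,j-1)$, $w=(i+1,j+1)$; (b) $v=(i+1,j-1)$, $w=(i-1,j+1)$; (c) $v=(i-1,j)$, $w=(i+1,j)$; (d) $v=(i,j-1)$, $w=(i,j+1)$; (e) $v=(i,j-1)$, $w=(i-1,j)$; (f) $v=(i,j-1)$, $w=(i+1,j)$; (g) $v=(i+1,j)$, $w=(i,j+1)$; (h) $v=(i-1,j)$, $w=(i,j+1)$. For $S\subseteq V_{n,m}$, the final contaminated set $C(S)$ is the smallest subset of $V_{n,m}$ containing $S$ and closed under rules (a)--(h). $S$ is a contaminating set if $C(S)=V_{n,m}$. The power contamination number $\gamma_c(G(n,m))$ is the minimum cardinality of a contaminating set; a contaminating set of this cardinality is an optimal solution. $\alpha_{n,m}$ denotes the number of optimal solutions of $G(n,m)$. A factor of a word $w_1\cdots w_t$ is a contiguous block $w_iw_{i+1}\cdots w_j$. Here A193519$(N)$ is understood as $3^{N}-u_{N}$, where $u_N$ is the number of words of length $N$ over $\{1,2,3\}$ avoiding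 both factors $13$ and $31$. -}

module Defs where

open import Data.Bool.Base using (Bool; true; false)
open import Data.Fin.Base using (Fin; toℕ)
open import Data.Fin.Patterns using (0F; 2F)
import Data.Fin.Properties as Fin
import Data.Fin.Subset as Sub
import Data.Fin.Subset.Properties as Sub
open import Data.List.Base
  using (List; []; _∷_; length; filter; allFin; cartesianProduct; cartesianProductWith)
open import Data.List.Membership.Propositional using (_∈_; _∉_; find; lose)
open import Data.List.Membership.Propositional.Properties
  using (∈-allFin; ∈-cartesianProduct⁺; ∈-cartesianProductWith⁺; ∈-filter⁺; ∈-filter⁻)
open import Data.List.Properties using (filter-notAll)
open import Data.List.Relation.Binary.Infix.Heterogeneous using (Infix)
open import Data.List.Relation.Binary.Infix.Heterogeneous.Properties using (infix?)
import Data.List.Relation.Unary.All as All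
import Data.List.Relation.Unary.AllPairs as AllPairs
import Data.List.Relation.Unary.Any as Any
open Any using (Any; here; there)
open import Data.List.Relation.Unary.Unique.Propositional using (Unique)
import Data.List.Relation.Unary.Unique.Propositional.Properties as Unique
open import Data.Nat.Base using (ℕ; zero; suc; _∸_; _^_; _≤_; _<_)
open import Data.Nat.Induction using (<-wellFounded)
open import Data.Nat.Properties using (_≟_; _≤?_)
open import Data.Product.Base using (∃-syntax; _×_; _,_; proj₁; proj₂)
open import Data.Product.Properties using (≡-dec)
open import Data.Sum.Base using (_⊎_; inj₁; inj₂)
open import Data.Vec.Base as Vec using (Vec; []; _∷_; toList)
open import Data.Vec.Properties using (∷-injective)
open import Function.Base using (_∘_)
open import Induction.WellFounded using (Acc; acc)
open import Level using (Level)
open import Relation.Binary.Definitions using (DecidableEquality)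
open import Relation.Binary.PropositionalEquality using (_≡_; refl)
open import Relation.Nullary.Decidable
  using (Dec; yes; no; map′; ¬?; decidable-stable; _×-dec_; _⊎-dec_; _→-dec_)
open import Relation.Nullary.Negation using (¬_)
open import Relation.Unary using (Pred; Decidable)

private
  variable
    a p : Level
    A : Set a
    n m N : ℕ

count : {P : Pred A p} → Decidable P → List A → ℕ
count P? = length ∘ filter P?

allVecs : List A → ∀ n → List (Vec A n)
allVecs xs zero    = [] ∷ []
allVecs xs (suc n) = cartesianProductWith _∷_ xs (allVecs xs n)

allVecs-complete : {xs : List A} → (∀ x → x ∈ xs) → (v : Vec A n) → v ∈ allVecs xs n
allVecs-complete all []      = here refl
allVecs-complete all (x ∷ v) =
  ∈-cartesianProductWith⁺ _∷_ (all x) (allVecs-complete all v)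

allVecs-unique : {xs : List A} → Unique xs → ∀ n → Unique (allVecs xs n)
allVecs-unique xs! zero    = All.[] AllPairs.∷ AllPairs.[]
allVecs-unique xs! (suc n) =
  Unique.cartesianProductWith⁺ _∷_ ∷-injective xs! (allVecs-unique xs! n)

-- Rows and columns are numbered from 0.
Cell : ℕ → ℕ → Set
Cell n m = Fin n × Fin m

_≟ᶜ_ : DecidableEquality (Cell n m)
_≟ᶜ_ = ≡-dec Fin._≟_ Fin._≟_

cells : ∀ n m → List (Cell n m)
cells n m = cartesianProduct (allFin n) (allFin m)

cells-complete : (c : Cell n m) → c ∈ cells n m
cells-complete (i , j) = ∈-cartesianProduct⁺ (∈-allFin i) (∈-allFin j)

-- A set of cells, given by its rows.
CellSet : ℕ → ℕ → Set
CellSet n m = Vec (Sub.Subset m) n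

infix 4 _∈ᶜ_ _∈ᶜ?_

_∈ᶜ_ : Cell n m → CellSet n m → Set
(i , j) ∈ᶜ S = j Sub.∈ Vec.lookup S i

_∈ᶜ?_ : (c : Cell n m) (S : CellSet n m) → Dec (c ∈ᶜ S)
(i , j) ∈ᶜ? S = j Sub.∈? Vec.lookup S i

card : CellSet n m → ℕ
card S = Vec.sum (Vec.map Sub.∣_∣ S)

bools : List Bool
bools = true ∷ false ∷ []

bools-complete : ∀ b → b ∈ bools
bools-complete true  = here refl
bools-complete false = there (here refl)

bools-unique : Unique bools
bools-unique =
  ((λ ()) All.∷ All.[]) AllPairs.∷ All.[] AllPairs.∷ AllPairs.[]

allSets : ∀ n m → List (CellSet n m)
allSets n m = allVecs (allVecs bools m) n

allSets-complete : (S : CellSet n m) → S ∈ allSets n m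
allSets-complete = allVecs-complete (allVecs-complete bools-complete)

allSets-unique : ∀ n m → Unique (allSets n m)
allSets-unique n m = allVecs-unique (allVecs-unique bools-unique m) n

infix 4 _⋖_ _⋖?_

_⋖_ : Fin n → Fin n → Set
i ⋖ j = toℕ j ≡ suc (toℕ i)

_⋖?_ : (i j : Fin n) → Dec (i ⋖ j)
i ⋖? j = toℕ j ≟ suc (toℕ i)

private
  variable
    i i⁻ i⁺ : Fin n
    j j⁻ j⁺ : Fin m

-- Rule u v w: the cell u can be contaminated by the cells v and w. In each
-- constructor u = (i , j), and i⁻, i⁺, j⁻, j⁺ stand for i - 1, i + 1, j - 1, j + 1.
data Rule {n m : ℕ} : Cell n m → Cell n m → Cell n m → Set where
  rule-a : i⁻ ⋖ i → j⁻ ⋖ j → i ⋖ i⁺ → j ⋖ j⁺ → Rule (i , j) (i⁻ , j⁻) (i⁺ , j⁺)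
  rule-b : i ⋖ i⁺ → j⁻ ⋖ j → i⁻ ⋖ i → j ⋖ j⁺ → Rule (i , j) (i⁺ , j⁻) (i⁻ , j⁺)
  rule-c : i⁻ ⋖ i → i ⋖ i⁺ → Rule (i , j) (i⁻ , j) (i⁺ , j)
  rule-d : j⁻ ⋖ j → j ⋖ j⁺ → Rule (i , j) (i , j⁻) (i , j⁺)
  rule-e : j⁻ ⋖ j → i⁻ ⋖ i → Rule (i , j) (i , j⁻) (i⁻ , j)
  rule-f : j⁻ ⋖ j → i ⋖ i⁺ → Rule (i , j) (i , j⁻) (i⁺ , j)
  rule-g : i ⋖ i⁺ → j ⋖ j⁺ → Rule (i , j) (i⁺ , j) (i , j⁺)
  rule-h : i⁻ ⋖ i → j ⋖ j⁺ → Rule (i , j) (i⁻ , j) (i , j⁺)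

rule? : (u v w : Cell n m) → Dec (Rule u v w)
rule? u@(i , j) v@(k , l) w@(r , s) = map′ to from
  (   (k ⋖? i ×-dec l ⋖? j ×-dec i ⋖? r ×-dec j ⋖? s)
  ⊎-dec (i ⋖? k ×-dec l ⋖? j ×-dec r ⋖? i ×-dec j ⋖? s)
  ⊎-dec (j Fin.≟ l ×-dec j Fin.≟ s ×-dec k ⋖? i ×-dec i ⋖? r)
  ⊎-dec (i Fin.≟ k ×-dec i Fin.≟ r ×-dec l ⋖? j ×-dec j ⋖? s)
  ⊎-dec (i Fin.≟ k ×-dec j Fin.≟ s ×-dec l ⋖? j ×-dec r ⋖? i)
  ⊎-dec (i Fin.≟ k ×-dec j Fin.≟ s ×-dec l ⋖? j ×-dec i ⋖? r)
  ⊎-dec (j Fin.≟ l ×-dec i Fin.≟ r ×-dec i ⋖? k ×-dec j ⋖? s)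
  ⊎-dec (j Fin.≟ l ×-dec i Fin.≟ r ×-dec k ⋖? i ×-dec j ⋖? s))
  where
  Cases : Set
  Cases = (k ⋖ i × l ⋖ j × i ⋖ r × j ⋖ s)
        ⊎ (i ⋖ k × l ⋖ j × r ⋖ i × j ⋖ s)
        ⊎ (j ≡ l × j ≡ s × k ⋖ i × i ⋖ r)
        ⊎ (i ≡ k × i ≡ r × l ⋖ j × j ⋖ s)
        ⊎ (i ≡ k × j ≡ s × l ⋖ j × r ⋖ i)
        ⊎ (i ≡ k × j ≡ s × l ⋖ j × i ⋖ r)
        ⊎ (j ≡ l × i ≡ r × i ⋖ k × j ⋖ s)
        ⊎ (j ≡ l × i ≡ r × k ⋖ i × j ⋖ s)

  to : Cases → Rule u v w
  to (inj₁ (x , y , z , t)) = rule-a x y z t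
  to (inj₂ (inj₁ (x , y , z , t))) = rule-b x y z t
  to (inj₂ (inj₂ (inj₁ (refl , refl , x , y)))) = rule-c x y
  to (inj₂ (inj₂ (inj₂ (inj₁ (refl , refl , x , y))))) = rule-d x y
  to (inj₂ (inj₂ (inj₂ (inj₂ (inj₁ (refl , refl , x , y)))))) = rule-e x y
  to (inj₂ (inj₂ (inj₂ (inj₂ (inj₂ (inj₁ (refl , refl , x , y))))))) = rule-f x y
  to (inj₂ (inj₂ (inj₂ (inj₂ (inj₂ (inj₂ (inj₁ (refl , refl , x , y)))))))) = rule-g x y
  to (inj₂ (inj₂ (inj₂ (inj₂ (inj₂ (inj₂ (inj₂ (refl , refl , x , y)))))))) = rule-h x y

  from : Rule u v w → Cases
  from (rule-a x y z t) = inj₁ (x , y , z , t)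
  from (rule-b x y z t) = inj₂ (inj₁ (x , y , z , t))
  from (rule-c x y) = inj₂ (inj₂ (inj₁ (refl , refl , x , y)))
  from (rule-d x y) = inj₂ (inj₂ (inj₂ (inj₁ (refl , refl , x , y))))
  from (rule-e x y) = inj₂ (inj₂ (inj₂ (inj₂ (inj₁ (refl , refl , x , y)))))
  from (rule-f x y) = inj₂ (inj₂ (inj₂ (inj₂ (inj₂ (inj₁ (refl , refl , x , y))))))
  from (rule-g x y) = inj₂ (inj₂ (inj₂ (inj₂ (inj₂ (inj₂ (inj₁ (refl , refl , x , y)))))))
  from (rule-h x y) = inj₂ (inj₂ (inj₂ (inj₂ (inj₂ (inj₂ (inj₂ (refl , refl , x , y)))))))

data C (S : CellSet n m) : Cell n m → Set where
  base : ∀ {c} → c ∈ᶜ S → C S c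
  step : ∀ {u v w} → Rule u v w → C S v → C S w → C S u

Contaminating : CellSet n m → Set
Contaminating S = ∀ c → C S c

Optimal : CellSet n m → Set
Optimal {n} {m} S =
  Contaminating S × ((T : CellSet n m) → Contaminating T → card S ≤ card T)

-- The closure is computed through its complement L, from which cells that a
-- rule derives from two cells outside L are removed until none is left.
module _ {n m : ℕ} (S : CellSet n m) where

  private
    Derivable : List (Cell n m) → Cell n m → Set
    Derivable L u =
      Any (λ v → Any (λ w → Rule u v w × v ∉ L × w ∉ L) (cells n m)) (cells n m)

    infix 4 _∈L?_
    _∈L?_ : (c : Cell n m) (L : List (Cell n m)) → Dec (c ∈ L)
    c ∈L? L = Any.any? (c ≟ᶜ_) L

    derivable? : ∀ L u → Dec (Derivable L u)
    derivable? L u = Any.any? (λ v → Any.any? (λ w →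
      rule? u v w ×-dec ¬? (v ∈L? L) ×-dec ¬? (w ∈L? L)) _) _

    saturate : (L : List (Cell n m)) → Acc _<_ (length L) →
               (∀ {c} → c ∉ L → C S c) → (∀ {c} → c ∈ᶜ S → c ∉ L) →
               ∃[ L′ ] (∀ {c} → c ∉ L′ → C S c) × (∀ {c} → C S c → c ∉ L′)
    saturate L (acc rec) sound base∉ with Any.any? (derivable? L) L
    ... | no ¬any = L , sound , complete
      where
      complete : ∀ {c} → C S c → c ∉ L
      complete (base c∈S)    c∈L = base∉ c∈S c∈L
      complete (step r v̂ ŵ) c∈L = ¬any (lose c∈L
        (lose (cells-complete _) (lose (cells-complete _) (r , complete v̂ , complete ŵ))))
    ... | yes any with find any
    ... | u , u∈L , d with find d
    ... | v , _ , d′ with find d′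
    ... | w , _ , r , v∉L , w∉L =
      saturate (filter ≢u? L) (rec (filter-notAll ≢u? L (lose u∈L λ u≢u → u≢u refl)))
        sound′ (λ {c} c∈S c∈L′ → base∉ {c} c∈S (proj₁ (∈-filter⁻ ≢u? c∈L′)))
      where
      ≢u? : Decidable (λ c → ¬ c ≡ u)
      ≢u? c = ¬? (c ≟ᶜ u)

      sound′ : ∀ {c} → c ∉ filter ≢u? L → C S c
      sound′ {c} c∉ with c ≟ᶜ u
      ... | yes refl = step r (sound v∉L) (sound w∉L)
      ... | no c≢u   = sound λ c∈L → c∉ (∈-filter⁺ ≢u? c∈L c≢u)

    ∉S? : Decidable (λ c → ¬ c ∈ᶜ S)
    ∉S? c = ¬? (c ∈ᶜ? S)

    saturated : ∃[ L ] (∀ {c} → c ∉ L → C S c) × (∀ {c} → C S c → c ∉ L)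
    saturated = saturate (filter ∉S? (cells n m)) (<-wellFounded _)
      (λ {c} c∉ → base (decidable-stable (c ∈ᶜ? S)
        λ c∉S → c∉ (∈-filter⁺ ∉S? (cells-complete c) c∉S)))
      (λ c∈S c∈ → proj₂ (∈-filter⁻ ∉S? {xs = cells n m} c∈) c∈S)

  C? : Decidable (C S)
  C? c with saturated
  ... | L , sound , complete = map′ sound complete (¬? (c ∈L? L))

contaminating? : Decidable (Contaminating {n} {m})
contaminating? S = map′ (λ f (i , j) → f i j) (λ f i j → f (i , j))
  (Fin.all? λ i → Fin.all? λ j → C? S (i , j))

optimal? : Decidable (Optimal {n} {m})
optimal? S = contaminating? S ×-dec map′
  (λ all T → All.lookup all (allSets-complete T))
  (λ f → All.tabulate λ {T} _ → f T)
  (All.all? (λ T → contaminating? T →-dec (card S ≤? card T)) (allSets _ _))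

-- Each set of cells is counted once, by allSets-complete and allSets-unique.
α : ℕ → ℕ → ℕ
α n m = count optimal? (allSets n m)

-- The elements 0, 1, 2 of Fin 3 stand for the letters 1, 2, 3.
Word : ℕ → Set
Word N = Vec (Fin 3) N

Factor : List (Fin 3) → Word N → Set
Factor f w = Infix _≡_ f (toList w)

factor? : ∀ f → Decidable (Factor {N} f)
factor? f w = infix? Fin._≟_ f (toList w)

f₁₃ f₃₁ : List (Fin 3)
f₁₃ = 0F ∷ 2F ∷ []
f₃₁ = 2F ∷ 0F ∷ []

Has13or31 : Word N → Set
Has13or31 w = Factor f₁₃ w ⊎ Factor f₃₁ w

has13or31? : Decidable (Has13or31 {N})
has13or31? w = factor? f₁₃ w ⊎-dec factor? f₃₁ w

Avoids13and31 : Word N → Set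
Avoids13and31 w = ¬ Factor f₁₃ w × ¬ Factor f₃₁ w

avoids13and31? : Decidable (Avoids13and31 {N})
avoids13and31? w = ¬? (factor? f₁₃ w) ×-dec ¬? (factor? f₃₁ w)

allWords : ∀ N → List (Word N)
allWords = allVecs (allFin 3)

allWords-complete : (w : Word N) → w ∈ allWords N
allWords-complete = allVecs-complete ∈-allFin

allWords-unique : ∀ N → Unique (allWords N)
allWords-unique = allVecs-unique (Unique.allFin⁺ 3)

#has13or31 : ℕ → ℕ
#has13or31 N = count has13or31? (allWords N)

#avoids13and31 : ℕ → ℕ
#avoids13and31 N = count avoids13and31? (allWords N)

-- Truncated subtraction is harmless: there are 3 ^ N words of length N.
A193519 : ℕ → ℕ
A193519 N = 3 ^ N ∸ #avoids13and31 N

{-# OPTIONS --safe #-}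
-- No rule crosses an empty first column, an empty last column or two adjacent empty columns.
-- So a contaminating set of the 3 × (2k + 1) grid meets each of the disjoint column blocks
-- {0, 1}, {2, 3}, …, {2k - 2, 2k - 1}, {2k} and has at least k + 1 cells. If it has exactly
-- k + 1, then, from left to right, each even column holds one cell and each odd column none:
-- the set is a word of k + 1 rows. A factor 13 or 31 fills three columns through their centre,
-- and from there full columns spread to both sides. Without such a factor the only new cells
-- lie between two equal letters, and every column keeps at most one contaminated cell.
module Submission where

open import Defs
open import Data.Bool.Base using (true; false)
open import Data.Empty using (⊥; ⊥-elim)
open import Data.Fin.Base using (Fin; zero; suc; toℕ; fromℕ)
open import Data.Fin.Patterns using (0F; 1F; 2F)
import Data.Fin.Properties as Fin
import Data.Fin.Subset as Sub
import Data.Fin.Subset.Properties as Sub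
open import Data.List.Base as List
  using (List; []; _∷_; length; filter; allFin; cartesianProductWith)
open import Data.List.Membership.Propositional using (_∈_)
open import Data.List.Membership.Propositional.Properties
  using (∈-filter⁺; ∈-filter⁻; ∈-map⁺; ∈-map⁻)
open import Data.List.Membership.Propositional.Properties.WithK using (unique∧set⇒bag)
open import Data.List.Properties using (filter-accept; filter-reject; length-++; length-map)
open import Data.List.Relation.Binary.BagAndSetEquality using (∼bag⇒↭)
open import Data.List.Relation.Binary.Infix.Heterogeneous using (here; there)
open import Data.List.Relation.Binary.Permutation.Propositional.Properties using (↭-length)
open import Data.List.Relation.Binary.Prefix.Heterogeneous using ([]; _∷_)
open import Data.List.Relation.Unary.Unique.Propositional using (Unique)
import Data.List.Relation.Unary.Unique.Propositional.Properties as Unique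
open import Data.Nat.Base using (ℕ; zero; suc; _+_; _*_; _∸_; _^_; _≤_; z≤n; s≤s)
open import Data.Nat.Properties
  using (≤-refl; ≤-trans; ≤-antisym; ≤-reflexive; module ≤-Reasoning; _≤?_; suc-injective;
         1+n≢n; <-irrefl; m≤m+n; m≤n+m; +-comm; +-suc; +-assoc; *-comm;
         +-commutativeSemigroup;
         +-mono-≤; +-monoʳ-≤; +-cancelʳ-≤; +-cancelˡ-≤; m+n∸n≡m)
open import Algebra.Properties.CommutativeSemigroup +-commutativeSemigroup using (x∙yz≈y∙xz)
open import Data.Product.Base using (∃-syntax; _×_; _,_; proj₁; proj₂)
open import Data.Sum.Base as Sum using (_⊎_; inj₁; inj₂; [_,_])
open import Data.Vec.Base as Vec using (Vec; []; _∷_; lookup; tabulate)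
open import Data.Vec.Properties
  using ([]=⇒lookup; lookup⇒[]=; lookup∘tabulate; lookup-map; ∷-injective)
open import Function.Base using (_∘_)
open import Function.Bundles using (mk⇔)
open import Relation.Binary.PropositionalEquality
  using (_≡_; refl; sym; trans; cong; cong₂; subst; module ≡-Reasoning)
open import Relation.Nullary.Decidable using (yes; no; does; dec-true; decidable-stable)
open import Relation.Nullary.Negation using (¬_; contradiction)
open import Relation.Unary using (Decidable)

private
  variable
    A B : Set
    n m k : ℕ

-- Counting

-- Filtering `ys` by `Q?` and mapping `f` over the filtered `xs` give two duplicate-free lists with
-- the same members, hence permutations of each other.
count-bijection :
  {P : A → Set} {Q : B → Set} (P? : Decidable P) (Q? : Decidable Q)
  {xs : List A} {ys : List B} → Unique xs → Unique ys →
  (∀ x → x ∈ xs) → (∀ y → y ∈ ys) →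
  (f : A → B) → (∀ {x x′} → f x ≡ f x′ → x ≡ x′) →
  (∀ x → P x → Q (f x)) → (∀ y → Q y → ∃[ x ] P x × y ≡ f x) →
  count Q? ys ≡ count P? xs
count-bijection P? Q? {xs} {ys} xs! ys! ∈xs ∈ys f f-injective P⇒Q Q⇒P = trans
  (↭-length (∼bag⇒↭ (unique∧set⇒bag
    (Unique.filter⁺ Q? ys!) (Unique.map⁺ f-injective (Unique.filter⁺ P? xs!)) (mk⇔ to from))))
  (length-map f (filter P? xs))
  where
  to : ∀ {y} → y ∈ filter Q? ys → y ∈ List.map f (filter P? xs)
  to {y} y∈ with Q⇒P y (proj₂ (∈-filter⁻ Q? {xs = ys} y∈))
  ... | x , px , refl = ∈-map⁺ f (∈-filter⁺ P? (∈xs x) px)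

  from : ∀ {y} → y ∈ List.map f (filter P? xs) → y ∈ filter Q? ys
  from y∈ with ∈-map⁻ f y∈
  ... | x , x∈ , refl =
    ∈-filter⁺ Q? (∈ys _) (P⇒Q x (proj₂ (∈-filter⁻ P? {xs = xs} x∈)))

count-complement :
  {P Q : A → Set} (P? : Decidable P) (Q? : Decidable Q) →
  (∀ {x} → P x → ¬ Q x) → (∀ {x} → ¬ P x → Q x) →
  ∀ xs → count P? xs + count Q? xs ≡ length xs
count-complement P? Q? P⇒¬Q ¬P⇒Q []       = refl
count-complement P? Q? P⇒¬Q ¬P⇒Q (x ∷ xs) with P? x
... | yes p rewrite filter-reject Q? {xs = xs} (P⇒¬Q p) =
  cong suc (count-complement P? Q? P⇒¬Q ¬P⇒Q xs)
... | no ¬p rewrite filter-accept Q? {xs = xs} (¬P⇒Q ¬p) =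
  trans (+-suc _ _) (cong suc (count-complement P? Q? P⇒¬Q ¬P⇒Q xs))

length-cartesianProductWith :
  ∀ {C : Set} (f : A → B → C) xs ys →
  length (cartesianProductWith f xs ys) ≡ length xs * length ys
length-cartesianProductWith f []       ys = refl
length-cartesianProductWith f (x ∷ xs) ys = trans (length-++ (List.map (f x) ys))
  (cong₂ _+_ (length-map (f x) ys) (length-cartesianProductWith f xs ys))

length-allWords : ∀ N → length (allWords N) ≡ 3 ^ N
length-allWords zero    = refl
length-allWords (suc N) =
  trans (length-cartesianProductWith _∷_ (allFin 3) (allWords N)) (cong (3 *_) (length-allWords N))

#has13or31≡A193519 : ∀ N → #has13or31 N ≡ A193519 N
#has13or31≡A193519 N = begin
  #has13or31 N                                       ≡⟨ m+n∸n≡m _ (#avoids13and31 N) ⟨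
  #has13or31 N + #avoids13and31 N ∸ #avoids13and31 N ≡⟨ cong (_∸ #avoids13and31 N) partition ⟩
  A193519 N                                          ∎
  where
  open ≡-Reasoning
  partition : #has13or31 N + #avoids13and31 N ≡ 3 ^ N
  partition = trans
    (count-complement has13or31? avoids13and31?
      (λ has (¬13 , ¬31) → [ ¬13 , ¬31 ] has) (λ ¬has → ¬has ∘ inj₁ , ¬has ∘ inj₂) (allWords N))
    (length-allWords N)

-- Closed predicates

Closed : (Cell n m → Set) → Set
Closed P = ∀ {u v w} → Rule u v w → P v → P w → P u

C-elim : {S : CellSet n m} {P : Cell n m → Set} →
         Closed P → (∀ {c} → c ∈ᶜ S → P c) → ∀ {c} → C S c → P c
C-elim closed base⊆ (base c∈S)    = base⊆ c∈S
C-elim closed base⊆ (step r v̂ ŵ) =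
  closed r (C-elim closed base⊆ v̂) (C-elim closed base⊆ ŵ)

⋖-irrefl : {i : Fin n} → ¬ i ⋖ i
⋖-irrefl i⋖i = 1+n≢n (sym i⋖i)

⋖-functional : {i j j′ : Fin n} → i ⋖ j → i ⋖ j′ → j ≡ j′
⋖-functional i⋖j i⋖j′ = Fin.toℕ-injective (trans i⋖j (sym i⋖j′))

⋖-injective : {i i′ j : Fin n} → i ⋖ j → i′ ⋖ j → i ≡ i′
⋖-injective i⋖j i′⋖j = Fin.toℕ-injective (suc-injective (trans (sym i⋖j) i′⋖j))

-- Empty columns

height : CellSet n m → Fin m → ℕ
height S j = Sub.∣ Vec.map (λ row → lookup row j) S ∣

∈ᶜ⇒1≤height : (S : CellSet n m) {i : Fin n} {j : Fin m} → (i , j) ∈ᶜ S → 1 ≤ height S j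
∈ᶜ⇒1≤height S {i} {j} ij∈S = ≤-trans (s≤s z≤n) (Sub.x∈p⇒∣p-x∣<∣p∣
  {p = Vec.map (λ row → lookup row j) S}
  (lookup⇒[]= i _ (trans (lookup-map i (λ row → lookup row j) S) ([]=⇒lookup ij∈S))))

-- A block of columns without an inner column flanked on both sides by outer columns.
Barrier : (Fin m → Set) → Set
Barrier D = ∀ {l c r} → l ⋖ c → c ⋖ r → D c → D l ⊎ D r

-- Rules c, e, f, g, h use a cell in the column of the new one; rules a, b, d use cells in both
-- neighbouring columns, one of which lies in `D` by the barrier condition.
barrier-clean : {D : Fin m → Set} {S : CellSet n m} → Barrier D →
                (∀ {c} → c ∈ᶜ S → ¬ D (proj₂ c)) → ∀ {c} → C S c → ¬ D (proj₂ c)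
barrier-clean {m} {n} {D} barrier = C-elim closed
  where
  closed : Closed {n} {m} (λ c → ¬ D (proj₂ c))
  closed (rule-a _ l _ r) ¬v ¬w = [ ¬v , ¬w ] ∘ barrier l r
  closed (rule-b _ l _ r) ¬v ¬w = [ ¬v , ¬w ] ∘ barrier l r
  closed (rule-c _ _)     ¬v ¬w = ¬v
  closed (rule-d l r)     ¬v ¬w = [ ¬v , ¬w ] ∘ barrier l r
  closed (rule-e _ _)     ¬v ¬w = ¬w
  closed (rule-f _ _)     ¬v ¬w = ¬w
  closed (rule-g _ _)     ¬v ¬w = ¬v
  closed (rule-h _ _)     ¬v ¬w = ¬v

contaminating⇒¬empty : {D : Fin m → Set} {S : CellSet (suc n) m} {j : Fin m} →
  Contaminating S → Barrier D → D j → ¬ (∀ {j} → D j → ¬ 1 ≤ height S j)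
contaminating⇒¬empty {D = D} {S} {j} cont barrier dj empty =
  barrier-clean {D = D} {S} barrier (λ c∈S d → empty d (∈ᶜ⇒1≤height S c∈S)) (cont (zero , j)) dj

-- What the cell count needs from a contaminating set. Unlike contamination, it survives the removal
-- of the first two columns, so inductions can run on it.
record Spanning (S : CellSet n (suc m)) : Set where
  field
    inner : ∀ {j j′} → j ⋖ j′ → 1 ≤ height S j + height S j′
    final : 1 ≤ height S (fromℕ m)

open Spanning

contaminating⇒spanning : {S : CellSet (suc n) (suc m)} → Contaminating S → Spanning S
contaminating⇒spanning {S = S} cont .inner {j} {j′} j⋖j′ =
  decidable-stable (1 ≤? height S j + height S j′) λ empty →
    contaminating⇒¬empty {D = λ i → i ≡ j ⊎ i ≡ j′} cont
      (λ { _   c⋖r (inj₁ refl) → inj₂ (inj₂ (⋖-functional c⋖r j⋖j′))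
         ; l⋖c _   (inj₂ refl) → inj₁ (inj₁ (⋖-injective l⋖c j⋖j′)) })
      (inj₁ refl)
      (λ { (inj₁ refl) 1≤ → empty (≤-trans 1≤ (m≤m+n _ _))
         ; (inj₂ refl) 1≤ → empty (≤-trans 1≤ (m≤n+m _ _)) })
contaminating⇒spanning {m = m} {S = S} cont .final =
  decidable-stable (1 ≤? height S (fromℕ m)) λ empty →
    contaminating⇒¬empty {D = _≡ fromℕ m} cont
      -- The last column has no right neighbour `r`: its index would be `suc m`.
      (λ { {r = r} _ c⋖r refl → contradiction (Fin.toℕ<n r)
             (<-irrefl (trans c⋖r (cong suc (Fin.toℕ-fromℕ m)))) })
      refl (λ { refl → empty })

contaminating⇒initial : {S : CellSet (suc n) (suc m)} → Contaminating S → 1 ≤ height S zero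
contaminating⇒initial {S = S} cont =
  decidable-stable (1 ≤? height S zero) λ empty →
    contaminating⇒¬empty {D = _≡ zero} cont (λ { () _ refl }) refl (λ { refl → empty })

-- Sets are stored by rows, but the counting arguments peel off columns.
card-column : (S : CellSet n (suc m)) →
              card S ≡ Sub.∣ Vec.map Vec.head S ∣ + card (Vec.map Vec.tail S)
card-column [] = refl
card-column ((true ∷ p) ∷ S) = cong suc
  (trans (cong (Sub.∣ p ∣ +_) (card-column S)) (x∙yz≈y∙xz Sub.∣ p ∣ Sub.∣ Vec.map Vec.head S ∣ _))
card-column ((false ∷ p) ∷ S) =
  trans (cong (Sub.∣ p ∣ +_) (card-column S)) (x∙yz≈y∙xz Sub.∣ p ∣ Sub.∣ Vec.map Vec.head S ∣ _)

spanning-tail² : {S : CellSet 3 (3 + m)} → Spanning S → Spanning (Vec.map (Vec.tail ∘ Vec.tail) S)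
spanning-tail² {S = (_ ∷ _ ∷ _) ∷ (_ ∷ _ ∷ _) ∷ (_ ∷ _ ∷ _) ∷ []} sp = record
  { inner = λ {j} {j′} j⋖j′ → sp .inner {suc (suc j)} {suc (suc j′)} (cong (2 +_) j⋖j′)
  ; final = sp .final
  }

spanning⇒card≥ : ∀ k (S : CellSet 3 (suc (k * 2))) → Spanning S → suc k ≤ card S
spanning⇒card≥ zero S@((_ ∷ []) ∷ (_ ∷ []) ∷ (_ ∷ []) ∷ []) sp = begin
  1                                                     ≤⟨ sp .final ⟩
  height S zero                                         ≤⟨ m≤m+n _ _ ⟩
  height S zero + card (Vec.map Vec.tail S)             ≡⟨ card-column S ⟨
  card S                                                ∎
  where open ≤-Reasoning
spanning⇒card≥ (suc k) S@((_ ∷ _ ∷ a) ∷ (_ ∷ _ ∷ b) ∷ (_ ∷ _ ∷ c) ∷ []) sp = begin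
  1 + suc k                             ≤⟨ +-mono-≤ (sp .inner {0F} {1F} refl)
                                             (spanning⇒card≥ k R (spanning-tail² sp)) ⟩
  height S 0F + height S 1F + card R    ≡⟨ +-assoc (height S 0F) (height S 1F) _ ⟩
  height S 0F + (height S 1F + card R)  ≡⟨ cong (height S 0F +_) (card-column (Vec.map Vec.tail S)) ⟨
  height S 0F + card (Vec.map Vec.tail S) ≡⟨ card-column S ⟨
  card S                                ∎
  where
  open ≤-Reasoning
  R = a ∷ b ∷ c ∷ []

-- Words as cell sets

-- The i-th letter of w (from 0) marks its row in column 2i; odd columns are empty.
row : Fin 3 → Word (suc k) → Sub.Subset (suc (k * 2))
row r (x ∷ [])    = does (x Fin.≟ r) ∷ []
row r (x ∷ y ∷ w) = does (x Fin.≟ r) ∷ false ∷ row r (y ∷ w)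

place : Word (suc k) → CellSet 3 (suc (k * 2))
place w = tabulate λ r → row r w

-- The tabulated form is what `place` unfolds to in the column of a letter `r`, so matching on the
-- equation rewrites that column in `spanning⇒place`.
singleton : ∀ x y z → Sub.∣ x ∷ y ∷ z ∷ [] ∣ ≡ 1 →
            ∃[ r ] x ∷ y ∷ z ∷ [] ≡ tabulate (λ i → does (r Fin.≟ i))
singleton true  false false _ = 0F , refl
singleton false true  false _ = 1F , refl
singleton false false true  _ = 2F , refl

∣p∣≡0⇒p≡⊥ : (p : Sub.Subset n) → Sub.∣ p ∣ ≡ 0 → p ≡ Sub.⊥
∣p∣≡0⇒p≡⊥ []          _  = refl
∣p∣≡0⇒p≡⊥ (false ∷ p) eq = cong (false ∷_) (∣p∣≡0⇒p≡⊥ p eq)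

-- Tightness of the count: the remaining columns already use `suc k` cells, so the first two share
-- exactly one, which `1 ≤ height S zero` puts in the first.
spanning⇒place : ∀ k (S : CellSet 3 (suc (k * 2))) → Spanning S → 1 ≤ height S zero →
                 card S ≤ suc k → ∃[ w ] S ≡ place {k} w
spanning⇒place zero S@((x ∷ []) ∷ (y ∷ []) ∷ (z ∷ []) ∷ []) sp initial card≤
  with singleton x y z (≤-antisym (begin
    height S zero                              ≤⟨ m≤m+n _ _ ⟩
    height S zero + card (Vec.map Vec.tail S)  ≡⟨ card-column S ⟨
    card S                                     ≤⟨ card≤ ⟩
    1                                          ∎) initial)
  where open ≤-Reasoning
... | r , refl = r ∷ [] , refl
spanning⇒place (suc k) S@((x ∷ x′ ∷ a) ∷ (y ∷ y′ ∷ b) ∷ (z ∷ z′ ∷ c) ∷ []) sp initial card≤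
  with singleton x y z h₀≡1 | ∣p∣≡0⇒p≡⊥ (x′ ∷ y′ ∷ z′ ∷ []) h₁≡0
     | spanning⇒place k R (spanning-tail² sp) initial′ cardR≤
  where
  open ≤-Reasoning
  R = a ∷ b ∷ c ∷ []
  h₀ = height S 0F
  h₁ = height S 1F

  total : h₀ + h₁ + card R ≤ 1 + suc k
  total = begin
    h₀ + h₁ + card R                ≡⟨ +-assoc h₀ h₁ _ ⟩
    h₀ + (h₁ + card R)              ≡⟨ cong (h₀ +_) (card-column (Vec.map Vec.tail S)) ⟨
    h₀ + card (Vec.map Vec.tail S)  ≡⟨ card-column S ⟨
    card S                          ≤⟨ card≤ ⟩
    1 + suc k                       ∎

  h₀+h₁≤1 : h₀ + h₁ ≤ 1
  h₀+h₁≤1 = +-cancelʳ-≤ (suc k) _ _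
    (≤-trans (+-monoʳ-≤ (h₀ + h₁) (spanning⇒card≥ k R (spanning-tail² sp))) total)

  h₀≡1 : h₀ ≡ 1
  h₀≡1 = ≤-antisym (≤-trans (m≤m+n _ _) h₀+h₁≤1) initial

  h₁≡0 : h₁ ≡ 0
  h₁≡0 = ≤-antisym (+-cancelˡ-≤ 1 _ _ (subst (λ h → h + h₁ ≤ 1) h₀≡1 h₀+h₁≤1)) z≤n

  -- With column 1 empty, `inner` forces a cell into column 2, so the hypothesis on the first column
  -- passes to `R`.
  initial′ : 1 ≤ height R zero
  initial′ = subst (λ h → 1 ≤ h + height R zero) h₁≡0 (sp .inner {1F} {2F} refl)

  cardR≤ : card R ≤ suc k
  cardR≤ = +-cancelˡ-≤ 1 _ _
    (≤-trans (+-mono-≤ (≤-trans initial (m≤m+n h₀ h₁)) ≤-refl) total)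
... | r , refl | refl | s ∷ w , refl = r ∷ s ∷ w , refl

card-place : (w : Word (suc k)) → card (place w) ≡ suc k
card-place (0F ∷ []) = refl
card-place (1F ∷ []) = refl
card-place (2F ∷ []) = refl
card-place {suc k} (x ∷ y ∷ w) = trans (card-column (place (x ∷ y ∷ w)))
  (cong₂ _+_ (letter x) (trans (card-column (Vec.map Vec.tail (place (x ∷ y ∷ w))))
    (card-place (y ∷ w))))
  where
  letter : ∀ x → Sub.∣ tabulate {n = 3} (λ i → does (x Fin.≟ i)) ∣ ≡ 1
  letter 0F = refl
  letter 1F = refl
  letter 2F = refl

∈-place⁺ : (w : Word (suc k)) {r : Fin 3} {j : Fin (suc (k * 2))} →
           lookup (row r w) j ≡ true → (r , j) ∈ᶜ place w
∈-place⁺ w {r} {j} eq =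
  lookup⇒[]= j _ (trans (cong (λ p → lookup p j) (lookup∘tabulate (λ r → row r w) r)) eq)

∈-place⁻ : (w : Word (suc k)) {r : Fin 3} {j : Fin (suc (k * 2))} →
           (r , j) ∈ᶜ place w → lookup (row r w) j ≡ true
∈-place⁻ w {r} {j} rj∈ =
  trans (cong (λ p → lookup p j) (sym (lookup∘tabulate (λ r → row r w) r))) ([]=⇒lookup rj∈)

row-head : ∀ x (w : Word k) → lookup (row x (x ∷ w)) zero ≡ true
row-head x []      = dec-true (x Fin.≟ x) refl
row-head x (_ ∷ _) = dec-true (x Fin.≟ x) refl

does-≟⇒≡ : (x r : Fin n) → does (x Fin.≟ r) ≡ true → r ≡ x
does-≟⇒≡ x r eq with x Fin.≟ r
... | yes refl = refl

row-head⁻ : ∀ x (w : Word k) {r} → lookup (row r (x ∷ w)) zero ≡ true → r ≡ x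
row-head⁻ x []      = does-≟⇒≡ x _
row-head⁻ x (_ ∷ _) = does-≟⇒≡ x _

-- Row `x` of `x ∷ v` starts with `true`, and only the letter `x` makes that row start so; hence the
-- first letters agree.
rows-injective : (v w : Word (suc k)) → (∀ r → row r v ≡ row r w) → v ≡ w
rows-injective (x ∷ v) (y ∷ w) eq
  with row-head⁻ y w (trans (cong (λ p → lookup p zero) (sym (eq x))) (row-head x v))
rows-injective (x ∷ [])     (x ∷ [])     eq | refl = refl
rows-injective (x ∷ y ∷ v) (x ∷ z ∷ w) eq | refl =
  cong (x ∷_) (rows-injective (y ∷ v) (z ∷ w)
    λ r → proj₂ (∷-injective (proj₂ (∷-injective (eq r)))))

place-injective : {v w : Word (suc k)} → place v ≡ place w → v ≡ w
place-injective {v = v} {w} eq = rows-injective v w λ r → begin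
  row r v             ≡⟨ lookup∘tabulate (λ r → row r v) r ⟨
  lookup (place v) r  ≡⟨ cong (λ S → lookup S r) eq ⟩
  lookup (place w) r  ≡⟨ lookup∘tabulate (λ r → row r w) r ⟩
  row r w             ∎
  where open ≡-Reasoning

-- Words with a factor 13 or 31

Adjacent : Fin n → Fin n → Set
Adjacent i j = i ⋖ j ⊎ j ⋖ i

-- An arbitrary closed `P` replaces `C S` because the induction on the word shifts `P` by two
-- columns, and the result is in general not the closure of the shorter word's set.
module Filling {m : ℕ} (P : Cell 3 m → Set) (closed : Closed P) where

  Full : Fin m → Set
  Full j = ∀ r → P (r , j)

  -- The four cases are rules g, h, f, e: one neighbour in the same row, one in the same column.
  corner : ∀ {i i′ j j′} → Adjacent i i′ → Adjacent j j′ → P (i , j′) → P (i′ , j) → P (i , j)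
  corner (inj₁ i⋖i′) (inj₁ j⋖j′) p q = closed (rule-g i⋖i′ j⋖j′) q p
  corner (inj₂ i′⋖i) (inj₁ j⋖j′) p q = closed (rule-h i′⋖i j⋖j′) q p
  corner (inj₁ i⋖i′) (inj₂ j′⋖j) p q = closed (rule-f j′⋖j i⋖i′) p q
  corner (inj₂ i′⋖i) (inj₂ j′⋖j) p q = closed (rule-e j′⋖j i′⋖i) p q

  -- A cell of column `j` beside a full column yields the middle cell of `j`, and the middle cell
  -- yields both outer ones.
  spread : ∀ {j j′} → Adjacent j j′ → Full j′ → ∀ r → P (r , j) → Full j
  spread {j} adj full r p = λ
    { 0F → corner (inj₁ refl) adj (full 0F) (centre r p)
    ; 1F → centre r p
    ; 2F → corner (inj₂ refl) adj (full 2F) (centre r p)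
    }
    where
    centre : ∀ r → P (r , j) → P (1F , j)
    centre 0F p = corner (inj₂ refl) adj (full 1F) p
    centre 1F p = p
    centre 2F p = corner (inj₁ refl) adj (full 1F) p

  spread² : ∀ {i j k} → Adjacent i j → Adjacent j k → Full k → ∀ r →
            P (r , i) → P (r , j) → Full i × Full j
  spread² ij jk full r p q = spread ij (spread jk full r q) r p , spread jk full r q

  -- Rule a contaminates the centre, which with the two given cells completes column `j`; this full
  -- column then spreads to both sides.
  diagonal₁₃ : ∀ {i j k} → i ⋖ j → j ⋖ k → P (0F , i) → P (2F , k) → Full i × Full j × Full k
  diagonal₁₃ {i} {j} {k} i⋖j j⋖k p q =
    spread (inj₁ i⋖j) full 0F p , full , spread (inj₂ j⋖k) full 2F q
    where
    centre : P (1F , j)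
    centre = closed (rule-a refl i⋖j refl j⋖k) p q

    full : Full j
    full 0F = corner (inj₁ refl) (inj₂ i⋖j) p centre
    full 1F = centre
    full 2F = corner (inj₂ refl) (inj₁ j⋖k) q centre

  diagonal₃₁ : ∀ {i j k} → i ⋖ j → j ⋖ k → P (2F , i) → P (0F , k) → Full i × Full j × Full k
  diagonal₃₁ {i} {j} {k} i⋖j j⋖k p q =
    spread (inj₁ i⋖j) full 2F p , full , spread (inj₂ j⋖k) full 0F q
    where
    centre : P (1F , j)
    centre = closed (rule-b refl i⋖j refl j⋖k) p q

    full : Full j
    full 0F = corner (inj₁ refl) (inj₁ j⋖k) q centre
    full 1F = centre
    full 2F = corner (inj₂ refl) (inj₂ i⋖j) p centre

open Filling

shift² : (Cell n (2 + m) → Set) → Cell n m → Set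
shift² P (i , j) = P (i , suc (suc j))

closed-shift² : {P : Cell n (2 + m) → Set} → Closed P → Closed (shift² P)
closed-shift² {n} {m} closed r = closed (rule r)
  where
  up : {i j : Fin m} → i ⋖ j → suc (suc i) ⋖ suc (suc j)
  up = cong (2 +_)

  rule : ∀ {u v w : Cell n m} → Rule u v w →
         Rule (proj₁ u , suc (suc (proj₂ u)))
              (proj₁ v , suc (suc (proj₂ v))) (proj₁ w , suc (suc (proj₂ w)))
  rule (rule-a x y z t) = rule-a x (up y) z (up t)
  rule (rule-b x y z t) = rule-b x (up y) z (up t)
  rule (rule-c x y)     = rule-c x y
  rule (rule-d x y)     = rule-d (up x) (up y)
  rule (rule-e x y)     = rule-e (up x) y
  rule (rule-f x y)     = rule-f (up x) y
  rule (rule-g x y)     = rule-g x (up y)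
  rule (rule-h x y)     = rule-h x (up y)

-- Stated through `row` rather than `place`, since `lookup (row r (x ∷ y ∷ w)) (suc (suc j))`
-- computes to `lookup (row r (y ∷ w)) j`: a proof for `x ∷ y ∷ w` serves unchanged for the shifted
-- predicate.
Marked : Word (suc k) → (Cell 3 (suc (k * 2)) → Set) → Set
Marked w P = ∀ {r j} → lookup (row r w) j ≡ true → P (r , j)

columns : {P : Cell n (3 + m) → Set} → (∀ r → P (r , 0F)) → (∀ r → P (r , 1F)) →
          (∀ c → shift² P c) → ∀ c → P c
columns p₀ p₁ p₂ (r , 0F)          = p₀ r
columns p₀ p₁ p₂ (r , 1F)          = p₁ r
columns p₀ p₁ p₂ (r , suc (suc j)) = p₂ (r , j)

-- Row `y` is contaminated in column 0, which is full, and in column 2 by its letter, so rule d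
-- gives its cell in column 1. One cell in each of columns 1 and 2 is enough for the full column to
-- spread over both.
fill-right : (w : Word (suc k)) {P : Cell 3 (suc (k * 2)) → Set} →
             Closed P → Marked w P → (∀ r → P (r , zero)) → ∀ c → P c
fill-right (x ∷ [])    closed marked full (r , zero) = full r
fill-right (x ∷ y ∷ w) {P} closed marked full =
  let full₂ , full₁ = spread² P closed {2F} {1F} {0F} (inj₂ refl) (inj₂ refl) full y marked₂
                        (closed (rule-d {j⁻ = 0F} {j⁺ = 2F} refl refl) (full y) marked₂)
  in columns {P = P} full full₁ (fill-right (y ∷ w) (closed-shift² {P = P} closed) marked full₂)
  where
  marked₂ : P (y , 2F)
  marked₂ = marked (row-head y w)

-- Induction on the position of the given factor. At the front it fills three columns and
-- `fill-right` does the rest; otherwise the columns from 2 on fill first and spread back over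
-- columns 1 and 0.
fill : (w : Word (suc k)) {P : Cell 3 (suc (k * 2)) → Set} →
       Has13or31 w → Closed P → Marked w P → ∀ c → P c
fill (_ ∷ []) (inj₁ (here (_ ∷ ())))
fill (_ ∷ []) (inj₁ (there (here ())))
fill (_ ∷ []) (inj₂ (here (_ ∷ ())))
fill (_ ∷ []) (inj₂ (there (here ())))
fill (x ∷ y ∷ w) {P} has closed marked = case has
  where
  marked₀ : P (x , 0F)
  marked₀ = marked (row-head x (y ∷ w))

  marked₂ : P (y , 2F)
  marked₂ = marked (row-head y w)

  right : (∀ r → P (r , 0F)) × (∀ r → P (r , 1F)) × (∀ r → P (r , 2F)) → ∀ c → P c
  right (full₀ , full₁ , full₂) = columns {P = P} full₀ full₁
    (fill-right (y ∷ w) (closed-shift² {P = P} closed) marked full₂)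

  left : Has13or31 (y ∷ w) → ∀ c → P c
  left has = columns {P = P} full₀ full₁ rest
    where
    rest : ∀ c → shift² P c
    rest = fill (y ∷ w) has (closed-shift² {P = P} closed) marked

    fulls : (∀ r → P (r , 0F)) × (∀ r → P (r , 1F))
    fulls = spread² P closed {0F} {1F} {2F} (inj₁ refl) (inj₁ refl) (λ r → rest (r , 0F)) x marked₀
      (closed (rule-d {j⁻ = 0F} {j⁺ = 2F} refl refl) marked₀ (rest (x , 0F)))

    full₀ = proj₁ fulls
    full₁ = proj₂ fulls

  case : Has13or31 (x ∷ y ∷ w) → ∀ c → P c
  case (inj₁ (here (refl ∷ refl ∷ []))) = right (diagonal₁₃ P closed refl refl marked₀ marked₂)
  case (inj₂ (here (refl ∷ refl ∷ []))) = right (diagonal₃₁ P closed refl refl marked₀ marked₂)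
  case (inj₁ (there p)) = left (inj₁ p)
  case (inj₂ (there p)) = left (inj₂ p)

has⇒contaminating : (w : Word (suc k)) → Has13or31 w → Contaminating (place w)
has⇒contaminating w has = fill w has step (base ∘ ∈-place⁺ w)

-- Words without the factors 13 and 31

-- The final contaminated set of place w when w avoids 13 and 31.
Trace : Word (suc k) → Fin 3 → ℕ → Set
Trace (x ∷ [])    r zero          = r ≡ x
Trace (x ∷ [])    r (suc _)       = ⊥
Trace (x ∷ y ∷ w) r zero          = r ≡ x
Trace (x ∷ y ∷ w) r (suc zero)    = r ≡ x × r ≡ y
Trace (x ∷ y ∷ w) r (suc (suc j)) = Trace (y ∷ w) r j

place⊆trace : (w : Word (suc k)) {r : Fin 3} (j : Fin (suc (k * 2))) →
              lookup (row r w) j ≡ true → Trace w r (toℕ j)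
place⊆trace (x ∷ [])    zero          eq = does-≟⇒≡ x _ eq
place⊆trace (x ∷ y ∷ w) zero          eq = does-≟⇒≡ x _ eq
place⊆trace (x ∷ y ∷ w) (suc (suc j)) eq = place⊆trace (y ∷ w) j eq

trace-head : ∀ x (w : Word k) {r} → Trace (x ∷ w) r 0 → r ≡ x
trace-head x []      t = t
trace-head x (_ ∷ _) t = t

-- Excludes rule c, and shows in the end that column 0 is never full.
trace-unique : (w : Word (suc k)) {r r′ : Fin 3} (j : ℕ) → Trace w r j → Trace w r′ j → r ≡ r′
trace-unique (x ∷ [])    zero          t t′ = trans t (sym t′)
trace-unique (x ∷ y ∷ w) zero          t t′ = trans t (sym t′)
trace-unique (x ∷ y ∷ w) (suc zero)    (t , _) (t′ , _) = trans t (sym t′)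
trace-unique (x ∷ y ∷ w) (suc (suc j)) t t′ = trace-unique (y ∷ w) j t t′

-- One of two adjacent columns is odd, and its cell must carry the letters of both its neighbours.
-- This excludes rules e to h, whose two cells lie in adjacent columns and different rows.
trace-adjacent : (w : Word (suc k)) {r r′ : Fin 3} {i j : ℕ} → j ≡ suc i →
                 Trace w r i → Trace w r′ j → r ≡ r′
trace-adjacent (x ∷ [])    {i = zero}        refl t ()
trace-adjacent (x ∷ y ∷ w) {i = zero}        refl t (t′ , _) = trans t (sym t′)
trace-adjacent (x ∷ y ∷ w) {i = suc zero}    refl (_ , t) t′ = trans t (sym (trace-head y w t′))
trace-adjacent (x ∷ y ∷ w) {i = suc (suc i)} refl t t′ = trace-adjacent (y ∷ w) {i = i} refl t t′

-- This settles rule d. An odd middle column has equal letters on its two sides; for an even one,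
-- the odd column on its left already carries its letter.
trace-fill : (w : Word (suc k)) {r : Fin 3} {i j l : ℕ} → j ≡ suc i → l ≡ suc j →
             Trace w r i → Trace w r l → Trace w r j
trace-fill (x ∷ [])        {i = zero}        refl refl t ()
trace-fill (x ∷ y ∷ w)     {i = zero}        refl refl t t′ = t , trace-head y w t′
trace-fill (x ∷ y ∷ z ∷ w) {i = suc zero}    refl refl (_ , t) t′ = t
trace-fill (x ∷ y ∷ w)     {i = suc (suc i)} refl refl t t′ =
  trace-fill (y ∷ w) {i = i} refl refl t t′

data Opposite : Fin 3 → Fin 3 → Set where
  opposite₁₃ : Opposite 0F 2F
  opposite₃₁ : Opposite 2F 0F

opposite-irrefl : ∀ {r} → ¬ Opposite r r
opposite-irrefl ()

opposite-sym : ∀ {r r′} → Opposite r r′ → Opposite r′ r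
opposite-sym opposite₁₃ = opposite₃₁
opposite-sym opposite₃₁ = opposite₁₃

-- Among three rows the only chain of three consecutive ones is 0, 1, 2.
⋖⋖⇒opposite : ∀ {i⁻ i i⁺ : Fin 3} → i⁻ ⋖ i → i ⋖ i⁺ → Opposite i⁻ i⁺
⋖⋖⇒opposite {0F} {1F} {2F} _ _ = opposite₁₃
⋖⋖⇒opposite {0F} {1F} {0F} _ ()
⋖⋖⇒opposite {0F} {1F} {1F} _ ()
⋖⋖⇒opposite {1F} {2F} {0F} _ ()
⋖⋖⇒opposite {1F} {2F} {1F} _ ()
⋖⋖⇒opposite {1F} {2F} {2F} _ ()
⋖⋖⇒opposite {0F} {2F} () _
⋖⋖⇒opposite {2F} {1F} () _
⋖⋖⇒opposite {2F} {2F} () _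

-- Columns `i` and `l` have the same parity. If even, they hold consecutive letters, which form the
-- factor; if odd, both rows equal the letter between them and cannot be opposite.
trace-opposite : (w : Word (suc k)) {r r′ : Fin 3} {i j l : ℕ} → j ≡ suc i → l ≡ suc j →
                 Trace w r i → Trace w r′ l → Opposite r r′ → Has13or31 w
trace-opposite (x ∷ []) {i = zero} refl refl t ()
trace-opposite (x ∷ y ∷ w) {i = zero} refl refl t t′ o with t | trace-head y w t′ | o
... | refl | refl | opposite₁₃ = inj₁ (here (refl ∷ refl ∷ []))
... | refl | refl | opposite₃₁ = inj₂ (here (refl ∷ refl ∷ []))
trace-opposite (x ∷ y ∷ z ∷ w) {i = suc zero} refl refl (_ , refl) (refl , _) o =
  ⊥-elim (opposite-irrefl o)
trace-opposite (x ∷ y ∷ w) {i = suc (suc i)} refl refl t t′ o =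
  Sum.map there there (trace-opposite (y ∷ w) {i = i} refl refl t t′ o)

-- Rules a and b would need a factor 13 or 31, rule c two cells in one column, rules e to h
-- different rows in adjacent columns; only rule d can apply.
trace-closed : (w : Word (suc k)) → ¬ Has13or31 w →
               Closed {3} {suc (k * 2)} (λ (r , j) → Trace w r (toℕ j))
trace-closed w ¬has (rule-a u l d r) t t′ =
  ⊥-elim (¬has (trace-opposite w l r t t′ (⋖⋖⇒opposite u d)))
trace-closed w ¬has (rule-b d l u r) t t′ =
  ⊥-elim (¬has (trace-opposite w l r t t′ (opposite-sym (⋖⋖⇒opposite u d))))
trace-closed w ¬has (rule-c u d) t t′ with refl ← trace-unique w _ t t′ =
  ⊥-elim (opposite-irrefl (⋖⋖⇒opposite u d))
trace-closed w ¬has (rule-d l r) t t′ = trace-fill w l r t t′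
trace-closed w ¬has (rule-e l u) t t′ with refl ← trace-adjacent w l t t′ = ⊥-elim (⋖-irrefl u)
trace-closed w ¬has (rule-f l d) t t′ with refl ← trace-adjacent w l t t′ = ⊥-elim (⋖-irrefl d)
trace-closed w ¬has (rule-g d r) t t′ with refl ← trace-adjacent w r t t′ = ⊥-elim (⋖-irrefl d)
trace-closed w ¬has (rule-h u r) t t′ with refl ← trace-adjacent w r t t′ = ⊥-elim (⋖-irrefl u)

contaminating⇒has : (w : Word (suc k)) → Contaminating (place w) → Has13or31 w
contaminating⇒has w cont = decidable-stable (has13or31? w) λ ¬has →
  let trace : ∀ c → Trace w (proj₁ c) (toℕ (proj₂ c))
      trace c = C-elim (trace-closed w ¬has)
        (λ {c} c∈ → place⊆trace w (proj₂ c) (∈-place⁻ w c∈)) (cont c)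
  -- Rows 0 and 1 would both lie in column 0 of the trace.
  in Fin.0≢1+n (trace-unique w 0 (trace (0F , zero)) (trace (1F , zero)))

-- Optimal solutions

has⇒optimal : (w : Word (suc k)) → Has13or31 w → Optimal (place w)
has⇒optimal {k} w has = has⇒contaminating w has , λ T cont →
  ≤-trans (≤-reflexive (card-place w)) (spanning⇒card≥ k T (contaminating⇒spanning cont))

optimal⇒has : (S : CellSet 3 (suc (suc k * 2))) → Optimal S →
              ∃[ w ] Has13or31 w × S ≡ place {suc k} w
optimal⇒has {k = k} S (cont , minimal)
  with spanning⇒place (suc k) S (contaminating⇒spanning cont) (contaminating⇒initial cont)
         (≤-trans (minimal (place w₀) (has⇒contaminating w₀ has₀)) (≤-reflexive (card-place w₀)))
  where
  w₀ : Word (2 + k)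
  -- A word with the factor 13 shows that `2 + k` cells suffice, so a minimal `S` has no more. The
  -- length `2 + k` leaves room for the factor.
  w₀ = 0F ∷ 2F ∷ Vec.replicate k 0F

  has₀ : Has13or31 w₀
  has₀ = inj₁ (here (refl ∷ refl ∷ []))
... | w , refl = w , contaminating⇒has w cont , refl

α≡#has13or31 : ∀ k → α 3 (suc (suc k * 2)) ≡ #has13or31 (2 + k)
α≡#has13or31 k = count-bijection has13or31? optimal?
  (allWords-unique _) (allSets-unique 3 _) allWords-complete allSets-complete
  place place-injective has⇒optimal (optimal⇒has {k = k})

proposition8 : (k : ℕ) → 1 ≤ k →
    (α 3 (2 * k + 1) ≡ #has13or31 (k + 1)) × (#has13or31 (k + 1) ≡ A193519 (k + 1))
proposition8 k@(suc l) _ =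
  (begin
    -- The width is handled as `suc (k * 2)`, because a successor of `k` then adds two columns by
    -- computation.
    α 3 (2 * k + 1)    ≡⟨ cong (α 3) (trans (+-comm (2 * k) 1) (cong suc (*-comm 2 k))) ⟩
    α 3 (suc (k * 2))  ≡⟨ α≡#has13or31 l ⟩
    #has13or31 (suc k) ≡⟨ cong #has13or31 (+-comm 1 k) ⟩
    #has13or31 (k + 1) ∎) ,
  #has13or31≡A193519 (k + 1)
  where open ≡-Reasoning
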